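{- Let $H$ be a graph on $k\geq 1$ edges with maximum degree $\Delta$. Then $$AR_s(H) \geq \frac{(k-1)^2}{2\Delta}.$$ Moreover, if $H$ has chromatic index $\chi'(H) = \Delta$, then $$AR_s(H) \geq \frac{k(k+1)}{2\Delta}.$$
   Context: All graphs are finite and simple. An edge-coloring is proper if adjacent edges receive distinct colors; the chromatic index $\chi'(H)$ is the smallest number of colors in a proper edge-coloring of $H$. An edge-colored graph is rainbow if all its edges have distinct colors. A copy of $H$ is a (not necessarily induced) subgraph isomorphic to $H$. $AR_s(H)$ is the smallest number of edges in a graph $G$ such that every proper edge-coloring of $G$ contains a rainbow copy of $H$. -}

module Defs where

open import Data.Bool using (Bool; T; T?)
open import Data.Fin using (Fin; _<?_)
open import Data.List using (List; length; map; filter; allFin; cartesianProduct)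
open import Data.List.Extrema.Nat using (max)
open import Data.Nat using (ℕ; _≤_)
open import Data.Product using (Σ-syntax; ∃-syntax; _×_; _,_)
open import Data.Sum using (_⊎_)
open import Function.Definitions using (Injective)
open import Relation.Binary.Definitions using (Symmetric)
open import Relation.Binary.PropositionalEquality using (_≡_; _≢_)
open import Relation.Nullary using (¬_)
open import Relation.Nullary.Decidable using (_×-dec_)

record Graph : Set where
  field
    order  : ℕ
    adj    : Fin order → Fin order → Bool

  Vertex : Set
  Vertex = Fin order

  Adj : Vertex → Vertex → Set
  Adj u v = T (adj u v)

  field
    symmetric : Symmetric Adj
    loopless  : ∀ u → ¬ Adj u u

open Graph public using (Vertex; Adj)

-- Each edge {u , v} is listed once, as the pair with u < v.
edges : (G : Graph) → List (Vertex G × Vertex G)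
edges G = filter (λ (u , v) → (u <? v) ×-dec T? (Graph.adj G u v))
                 (cartesianProduct (allFin _) (allFin _))

numEdges : Graph → ℕ
numEdges G = length (edges G)

degree : (G : Graph) → Vertex G → ℕ
degree G u = length (filter (λ v → T? (Graph.adj G u v)) (allFin _))

maxDegree : Graph → ℕ
maxDegree G = max 0 (map (degree G) (allFin _))

-- `colour` is given on ordered adjacent pairs; `colour-sym` makes it a
-- function of the undirected edge.
record ProperColouring (G : Graph) (C : Set) : Set where
  field
    colour     : ∀ u v → Adj G u v → C
    colour-sym : ∀ u v (e : Adj G u v) (e′ : Adj G v u) →
                 colour u v e ≡ colour v u e′
    proper     : ∀ u v w (e : Adj G u v) (f : Adj G u w) →
                 v ≢ w → colour u v e ≢ colour u w f

IsMinimum : (ℕ → Set) → ℕ → Set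
IsMinimum P m = P m × (∀ n → P n → m ≤ n)

IsChromaticIndex : Graph → ℕ → Set
IsChromaticIndex G = IsMinimum (λ r → ProperColouring G (Fin r))

-- A copy of H in G, presented by an isomorphism from H onto a (not
-- necessarily induced) subgraph of G.
record Copy (H G : Graph) : Set where
  field
    vertex    : Vertex H → Vertex G
    injective : Injective _≡_ _≡_ vertex
    edge      : ∀ {u v} → Adj H u v → Adj G (vertex u) (vertex v)

-- Two pairs of adjacent vertices of H whose images have the same colour
-- span the same undirected edge.
Rainbow : ∀ {H G C} → ProperColouring G C → Copy H G → Set
Rainbow {H} c φ =
  ∀ u v x y (e : Adj H u v) (f : Adj H x y) →
  colour (vertex u) (vertex v) (edge e) ≡ colour (vertex x) (vertex y) (edge f) →
  (u ≡ x × v ≡ y) ⊎ (u ≡ y × v ≡ x)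
  where
  open ProperColouring c
  open Copy φ

-- Colours in ℕ suffice, since a finite graph uses only finitely many.
ForcesRainbow : Graph → Graph → Set
ForcesRainbow G H = (c : ProperColouring G ℕ) → Σ[ φ ∈ Copy H G ] Rainbow c φ

-- IsARₛ H a says that AR_s(H) = a.
IsARₛ : Graph → ℕ → Set
IsARₛ H = IsMinimum (λ m → ∃[ G ] (numEdges G ≡ m × ForcesRainbow G H))

{-# OPTIONS --safe #-}

-- Say that A forces m if every proper colouring of A contains a rainbow partial copy of H with
-- at least m edges.
--
-- If A forces m + 1, some vertex has degree at least m, for otherwise Vizing's theorem colours A
-- with m colours.  Giving the edges at that vertex fresh distinct colours shows that the rest of A
-- still forces m + 1 − Δ, since a copy of H uses at most Δ of these edges.  Iterating, A has at
-- least m + (m − Δ) + (m − 2Δ) + ⋯ ≥ m² / 2Δ edges.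
--
-- If H is Δ-edge-colourable and A forces m, then a partial copy of H in A with m edges contains a
-- matching of size at least m / Δ.  Giving that matching a single fresh colour shows that the rest
-- of A still forces m − 1, so A has at least (m + (m − 1) + ⋯ + 1) / Δ edges.
--
-- Vizing's theorem is proved by colouring one edge xy₀ at a time.  Let β u be a colour missing at u
-- and y₍ₗ₊₁₎ the neighbour of x along colour β yₗ.  At the first j for which β yⱼ is missing at x,
-- the whole fan is recoloured by β.  If instead β yᵢ = β yⱼ = d with i < j, the colours d and
-- a = β x are first exchanged on the Kempe component of x, which cannot contain both yᵢ and yⱼ.

module Submission where

open import Data.Bool using (T?)
open import Data.Bool.Properties using (T-irrelevant)
open import Data.Empty using (⊥; ⊥-elim)
open import Data.Fin as Fin using (Fin; toℕ)
open import Data.Fin.Permutation.Components using (transpose; transpose-inverse)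
import Data.Fin.Properties as Finₚ
open import Data.List using (List; []; _∷_; length; map; filter; allFin; lookup; cartesianProduct)
open import Data.List.Extrema.Nat using (xs≤max)
import Data.List.Membership.DecPropositional as DecMembership
open import Data.List.Membership.Propositional using (_∈_)
open import Data.List.Membership.Propositional.Properties using (∈-lookup; ∈-filter⁺; ∈-filter⁻; ∈-allFin; ∈-cartesianProduct⁺; ∈-map⁺)
open import Data.List.Properties using (length-tabulate; length-filter; filter-all; filter-none)
import Data.List.Relation.Unary.All as All
open import Data.List.Relation.Unary.AllPairs using (_∷_)
open import Data.List.Relation.Unary.Any using (here; there; index)
open import Data.List.Relation.Unary.Any.Properties using (lookup-index)
open import Data.List.Relation.Unary.Unique.Propositional using (Unique)
import Data.List.Relation.Unary.Unique.Propositional.Properties as Uniqueₚ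
open import Data.Nat as ℕ using (ℕ; zero; suc; _+_; _*_; _∸_; _^_; _≤_; _<_; z≤n; s≤s; _≤?_)
open import Data.Nat.Properties
open import Data.Nat.Solver using (module +-*-Solver)
open import Data.Product using (Σ-syntax; ∃; ∃-syntax; _×_; _,_; proj₁; proj₂)
open import Data.Product.Properties using (≡-dec)
open import Data.Sum as Sum using (_⊎_; inj₁; inj₂)
open import Data.Unit using (⊤; tt)
open import Function using (_∘_; case_of_; id)
open import Function.Definitions using (Injective)
open import Level using (0ℓ)
import Relation.Binary as B
open import Relation.Binary using (Rel; Symmetric; tri<; tri≈; tri>)
open import Relation.Binary.PropositionalEquality
open import Relation.Nullary using (¬_; Dec; yes; no)
open import Relation.Nullary.Decidable using (dec-true; dec-false; _×-dec_; _⊎-dec_; ¬?; decidable-stable)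
open import Relation.Unary using (Pred; Decidable)
open import Defs

private variable
  X Y C : Set
  n : ℕ

-- Bounded search and counting in lists

least : {P : Pred ℕ 0ℓ} → Decidable P → ∀ N → P N →
        ∃[ j ] j ≤ N × P j × (∀ i → i < j → ¬ P i)
least P? zero p = 0 , z≤n , p , λ _ ()
least P? (suc N) p with P? 0
... | yes p₀ = 0 , z≤n , p₀ , λ _ ()
... | no ¬p₀ with least (P? ∘ suc) N p
... | j , j≤N , pj , below = suc j , s≤s j≤N , pj , λ where
  zero    _         → ¬p₀
  (suc i) (s≤s i<j) → below i i<j

lookup-injective : {xs : List X} → Unique xs → ∀ i j → lookup xs i ≡ lookup xs j → i ≡ j
lookup-injective (x∉ ∷ u) Fin.zero    Fin.zero    _  = refl
lookup-injective (x∉ ∷ u) Fin.zero    (Fin.suc j) eq = ⊥-elim (All.lookup x∉ (∈-lookup j) eq)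
lookup-injective (x∉ ∷ u) (Fin.suc i) Fin.zero    eq = ⊥-elim (All.lookup x∉ (∈-lookup i) (sym eq))
lookup-injective (x∉ ∷ u) (Fin.suc i) (Fin.suc j) eq = cong Fin.suc (lookup-injective u i j eq)

-- Each position in `xs` is sent to the position of its image in `ys`; uniqueness of `xs` turns
-- equal entries back into equal positions. Most of the edge counts below are instances of this.
injection⇒length≤ : {xs : List X} {ys : List Y} (f : X → Y) → Unique xs →
                    (∀ {x} → x ∈ xs → f x ∈ ys) →
                    (∀ {x x′} → x ∈ xs → x′ ∈ xs → f x ≡ f x′ → x ≡ x′) →
                    length xs ≤ length ys
injection⇒length≤ {xs = xs} {ys} f u f∈ f-inj =
  Finₚ.injective⇒≤ {f = λ i → index (f∈ (∈-lookup {xs = xs} i))} λ {i} {j} eq →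
    lookup-injective u i j (f-inj (∈-lookup i) (∈-lookup j)
      (trans (lookup-index (f∈ (∈-lookup i)))
      (trans (cong (lookup ys) eq) (sym (lookup-index (f∈ (∈-lookup j)))))))

length-filter-split : {P Q R : Pred X 0ℓ} (P? : Decidable P) (Q? : Decidable Q) (R? : Decidable R) →
  (∀ {x} → P x → Q x ⊎ R x) → (∀ {x} → Q x → P x) → (∀ {x} → R x → P x) →
  (∀ {x} → Q x → ¬ R x) → ∀ xs →
  length (filter P? xs) ≡ length (filter Q? xs) + length (filter R? xs)
length-filter-split P? Q? R? split Q⇒P R⇒P Q⇒¬R [] = refl
length-filter-split P? Q? R? split Q⇒P R⇒P Q⇒¬R (x ∷ xs)
  with ih ← length-filter-split P? Q? R? split Q⇒P R⇒P Q⇒¬R xs | P? x | Q? x | R? x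
... | yes p | yes q | yes r = ⊥-elim (Q⇒¬R q r)
... | yes p | yes q | no ¬r = cong suc ih
... | yes p | no ¬q | yes r = trans (cong suc ih) (sym (+-suc _ _))
... | yes p | no ¬q | no ¬r = ⊥-elim (case split p of λ { (inj₁ q) → ¬q q ; (inj₂ r) → ¬r r })
... | no ¬p | yes q | _     = ⊥-elim (¬p (Q⇒P q))
... | no ¬p | no ¬q | yes r = ⊥-elim (¬p (R⇒P r))
... | no ¬p | no ¬q | no ¬r = ih

-- Pigeonhole by induction on `q`: the class of `suc q` is compared with the best earlier one, and
-- the larger of the two bounds both summands.
largest-class : ∀ {X : Set} (f : X → ℕ) xs q →
  ∃[ i ] length (filter (λ x → f x ≤? q) xs) ≤ suc q * length (filter (λ x → f x ℕ.≟ i) xs)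
-- The predicates `≤ 0` and `≡ 0` differ as terms, so their filters are compared by splitting off an
-- empty class.
largest-class f xs zero = 0 , ≤-reflexive (trans
  (length-filter-split {R = λ _ → ⊥} (λ x → f x ≤? 0) (λ x → f x ℕ.≟ 0) (λ _ → no λ ())
    (inj₁ ∘ n≤0⇒n≡0) ≤-reflexive (λ ()) (λ _ ()) xs)
  (cong (length (filter (λ x → f x ℕ.≟ 0) xs) +_) (cong length (filter-none (λ _ → no λ ()) (All.universal (λ _ ()) xs)))))
largest-class f xs (suc q) with i , below ← largest-class f xs q = choose (≤-total (count (suc q)) (count i))
  where
  open ≤-Reasoning
  count : ℕ → ℕ
  count i = length (filter (λ x → f x ℕ.≟ i) xs)
  split : length (filter (λ x → f x ≤? suc q) xs) ≤ count (suc q) + suc q * count i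
  split = ≤-trans (≤-reflexive (length-filter-split (λ x → f x ≤? suc q) (λ x → f x ℕ.≟ suc q) (λ x → f x ≤? q)
    (λ fx≤ → Sum.swap (Sum.map₁ ≤-pred (m≤n⇒m<n∨m≡n fx≤))) ≤-reflexive m≤n⇒m≤1+n
    (λ eq fx≤q → 1+n≰n (subst (_≤ q) eq fx≤q)) xs)) (+-monoʳ-≤ (count (suc q)) below)
  choose : count (suc q) ≤ count i ⊎ count i ≤ count (suc q) →
    ∃[ i ] length (filter (λ x → f x ≤? suc q) xs) ≤ suc (suc q) * count i
  choose (inj₁ top≤) = i , ≤-trans split (+-monoˡ-≤ _ top≤)
  choose (inj₂ ≤top) = suc q , ≤-trans split (+-monoʳ-≤ (count (suc q)) (*-monoʳ-≤ (suc q) ≤top))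

-- Orbits of two involutions

-- The orbit of x under ⟨f , g⟩ is {(g f)ᵏ x}; if f fixes x and N is the period of x under
-- g f, then f (g f)ⁱ x = (g f)ᴺ⁻ⁱ x and g (g f)ⁱ x = (g f)ᴺ⁺¹⁻ⁱ x, so any further fixed
-- point has 2 i = N or 2 i = N + 1, and parity leaves room for only one.
module Orbit (f g : Fin n → Fin n) (f-invol : ∀ u → f (f u) ≡ u) (g-invol : ∀ u → g (g u) ≡ u)
             (x : Fin n) (fx≡x : f x ≡ x) where

  walk : ℕ → Fin n
  walk zero    = x
  walk (suc k) = g (f (walk k))

  cancel : ∀ i k → walk i ≡ walk (i + k) → walk k ≡ x
  cancel zero    k eq = sym eq
  cancel (suc i) k eq = cancel i k
    (trans (sym (f-invol _)) (trans (cong f (trans (sym (g-invol _)) (trans (cong g eq) (g-invol _)))) (f-invol _)))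

  cancel-∸ : ∀ {i j} → i < j → walk i ≡ walk j → walk (j ∸ i) ≡ x
  cancel-∸ {i} {j} i<j eq = cancel i (j ∸ i) (trans eq (cong walk (sym (m+[n∸m]≡n (<⇒≤ i<j)))))

  -- Two of the `n + 1` points `walk 0`, ..., `walk n` coincide. Writing the time as a successor
  -- excludes the trivial return at time 0.
  returns : ∃[ k ] walk (suc k) ≡ x
  returns with Finₚ.pigeonhole (n<1+n n) (walk ∘ toℕ)
  ... | i , j , i<j , eq = ℕ.pred (toℕ j ∸ toℕ i) ,
    trans (cong walk (suc-pred _ {{ℕ.>-nonZero (m<n⇒0<n∸m i<j)}})) (cancel-∸ i<j eq)

  first-return : ∃[ j ] j ≤ proj₁ returns × walk (suc j) ≡ x × (∀ i → i < j → ¬ walk (suc i) ≡ x)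
  first-return = least (λ k → walk (suc k) Finₚ.≟ x) (proj₁ returns) (proj₂ returns)

  N : ℕ
  N = suc (proj₁ first-return)

  walk-N : walk N ≡ x
  walk-N = proj₁ (proj₂ (proj₂ first-return))

  walk≢x : ∀ {k} → 0 < k → k < N → walk k ≢ x
  walk≢x {suc k} _ (s≤s k<) = proj₂ (proj₂ (proj₂ first-return)) k k<

  -- A repetition would bring the walk back to `x` after `j ∸ i` steps, which is less than `N`
  -- because `i` is positive.
  no-repeat : ∀ {i j} → 0 < i → i < j → j ≤ N → walk i ≢ walk j
  no-repeat {i} {j} 0<i i<j j≤N eq =
    walk≢x (m<n⇒0<n∸m i<j) (<-≤-trans (∸-monoʳ-< 0<i (<⇒≤ i<j)) j≤N) (cancel-∸ i<j eq)

  walk-injective : ∀ {i j} → 0 < i → i ≤ N → 0 < j → j ≤ N → walk i ≡ walk j → i ≡ j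
  walk-injective {i} {j} 0<i i≤N 0<j j≤N eq with <-cmp i j
  ... | tri< i<j _ _ = ⊥-elim (no-repeat 0<i i<j j≤N eq)
  ... | tri≈ _ i≡j _ = i≡j
  ... | tri> _ _ j<i = ⊥-elim (no-repeat 0<j j<i i≤N (sym eq))

  -- The equation `i + j ≡ N` replaces the truncated subtraction `N ∸ i`, so that the induction
  -- moves one step from `j` to `i`.
  f-walk : ∀ i j → i + j ≡ N → f (walk i) ≡ walk j
  f-walk zero    j refl = trans fx≡x (sym walk-N)
  f-walk (suc i) j eq   =
    trans (cong (f ∘ g) (f-walk i (suc j) (trans (+-suc i j) eq))) (trans (cong f (g-invol _)) (f-invol _))

  g-walk : ∀ i j → i + j ≡ N → g (walk (suc i)) ≡ walk j
  g-walk i j eq = trans (g-invol _) (f-walk i j eq)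

  -- The indices 1 to `N` list every point of the orbit once, with `x` at `N`; the bound makes
  -- membership decidable.
  InOrbit : Pred (Fin n) 0ℓ
  InOrbit u = ∃[ k ] k < N × walk (suc k) ≡ u

  inOrbit? : Decidable InOrbit
  inOrbit? u = anyUpTo? (λ k → walk (suc k) Finₚ.≟ u) N

  walk∈ : ∀ {j} → j ≤ N → InOrbit (walk j)
  walk∈ {zero}  _    = proj₁ first-return , ≤-refl , walk-N
  walk∈ {suc j} j<N  = j , j<N , refl

  x∈ : InOrbit x
  x∈ = walk∈ z≤n

  f-closed : ∀ {u} → InOrbit u → InOrbit (f u)
  f-closed (k , k<N , refl) =
    subst InOrbit (sym (f-walk (suc k) (N ∸ suc k) (m+[n∸m]≡n k<N))) (walk∈ (m∸n≤m N (suc k)))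

  g-closed : ∀ {u} → InOrbit u → InOrbit (g u)
  g-closed (k , k<N , refl) =
    subst InOrbit (sym (g-walk k (N ∸ k) (m+[n∸m]≡n (<⇒≤ k<N)))) (walk∈ (m∸n≤m N k))

  Endpoint : Pred (Fin n) 0ℓ
  Endpoint u = f u ≡ u ⊎ g u ≡ u

  endpoint-index : ∀ {u} → InOrbit u → u ≢ x → Endpoint u →
                   ∃[ i ] walk i ≡ u × (2 * i ≡ N ⊎ 2 * i ≡ suc N)
  endpoint-index {u} (k , k<N , refl) u≢x end = suc k , refl , index-eq end
    where
    -- Index `N` belongs to `x`. Excluding it keeps the mirror index `N ∸ suc k` positive, within
    -- the range of `walk-injective`.
    sk<N : suc k < N
    sk<N = ≤∧≢⇒< k<N λ eq → u≢x (trans (cong walk eq) walk-N)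
    double : ∀ {j} → suc k ≡ j → suc k + j ≡ 2 * suc k
    double refl = cong (suc k +_) (sym (+-identityʳ (suc k)))
    index-eq : Endpoint u → 2 * suc k ≡ N ⊎ 2 * suc k ≡ suc N
    index-eq (inj₁ fu≡u) = inj₁ (trans (sym (double
      (walk-injective (s≤s z≤n) k<N (m<n⇒0<n∸m sk<N) (m∸n≤m N (suc k))
        (trans (sym fu≡u) (f-walk (suc k) (N ∸ suc k) (m+[n∸m]≡n k<N))))))
      (m+[n∸m]≡n k<N))
    index-eq (inj₂ gu≡u) = inj₂ (trans (sym (double
      (walk-injective (s≤s z≤n) k<N (m<n⇒0<n∸m k<N) (m∸n≤m N k)
        (trans (sym gu≡u) (g-walk k (N ∸ k) (m+[n∸m]≡n (<⇒≤ k<N)))))))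
      (cong suc (m+[n∸m]≡n (<⇒≤ k<N))))

  one-endpoint : ∀ {y z} → y ≢ x → z ≢ x → y ≢ z → Endpoint y → Endpoint z →
                 InOrbit y → ¬ InOrbit z
  one-endpoint y≢x z≢x y≢z y-end z-end y∈ z∈
    with endpoint-index y∈ y≢x y-end | endpoint-index z∈ z≢x z-end
  ... | i , refl , inj₁ p | j , refl , inj₁ q = y≢z (cong walk (*-cancelˡ-≡ i j 2 (trans p (sym q))))
  ... | i , refl , inj₂ p | j , refl , inj₂ q = y≢z (cong walk (*-cancelˡ-≡ i j 2 (trans p (sym q))))
  ... | i , refl , inj₁ p | j , refl , inj₂ q = even≢odd j i (trans q (cong suc (sym p)))
  ... | i , refl , inj₂ p | j , refl , inj₁ q = even≢odd i j (trans p (cong suc (sym q)))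

-- Vizing's theorem

neighbours : {R : Rel (Fin n) 0ℓ} → B.Decidable R → Fin n → List (Fin n)
neighbours R? u = filter (R? u) (allFin _)

-- `colour` is total, with arbitrary values off `R`, so passing to a subrelation keeps the same
-- function and needs no adjacency proofs.
record EdgeColouring (R : Rel (Fin n) 0ℓ) (C : Set) : Set where
  field
    colour     : Fin n → Fin n → C
    colour-sym : ∀ {u v} → R u v → colour u v ≡ colour v u
    proper     : ∀ {u v w} → R u v → R u w → colour u v ≡ colour u w → v ≡ w

open EdgeColouring

restrict : {R S : Rel (Fin n) 0ℓ} → (∀ {u v} → S u v → R u v) → EdgeColouring R C → EdgeColouring S C
restrict S⊆R κ = record
  { colour     = colour κ
  ; colour-sym = colour-sym κ ∘ S⊆R
  ; proper     = λ r s → proper κ (S⊆R r) (S⊆R s)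
  }

-- Recolouring: transpositions, fans and Kempe swaps

module _ (a d : Fin n) where

  transpose-matchˡ : transpose a d a ≡ d
  transpose-matchˡ rewrite dec-true (a Finₚ.≟ a) refl = refl

  transpose-matchʳ : transpose a d d ≡ a
  transpose-matchʳ with d Finₚ.≟ a
  ... | yes d≡a = d≡a
  ... | no _ rewrite dec-true (d Finₚ.≟ d) refl = refl

  transpose-mismatch : ∀ {c} → c ≢ a → c ≢ d → transpose a d c ≡ c
  transpose-mismatch {c} c≢a c≢d
    rewrite dec-false (c Finₚ.≟ a) c≢a | dec-false (c Finₚ.≟ d) c≢d = refl

  transpose-injective : ∀ {c e} → transpose a d c ≡ transpose a d e → c ≡ e
  transpose-injective eq =
    trans (sym (transpose-inverse d a)) (trans (cong (transpose d a) eq) (transpose-inverse d a))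

  transpose-involutive : ∀ {c} → transpose a d (transpose a d c) ≡ c
  transpose-involutive {c} = case ((c Finₚ.≟ a) , (c Finₚ.≟ d)) of λ where
    (yes refl , _)        → trans (cong (transpose a d) transpose-matchˡ) transpose-matchʳ
    (no _     , yes refl) → trans (cong (transpose a d) transpose-matchʳ) transpose-matchˡ
    (no c≢a   , no c≢d)   → trans (cong (transpose a d) (transpose-mismatch c≢a c≢d)) (transpose-mismatch c≢a c≢d)

-- Recolouring every xv with v ∈ F by β v frees the colours of a whole fan at once.
module Recolour {R R′ : Rel (Fin n) 0ℓ} (κ : EdgeColouring R C) (x : Fin n)
  {F : Pred (Fin n) 0ℓ} (F? : Decidable F) (x∉F : ¬ F x) (β : Fin n → C)
  (β-missing : ∀ {y w} → F y → R y w → colour κ y w ≢ β y)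
  (β-injective : ∀ {y z} → F y → F z → β y ≡ β z → y ≡ z)
  (F-closed : ∀ {y z} → F y → R x z → colour κ x z ≡ β y → F z)
  (R′-split : ∀ {u v} → R′ u v → R u v ⊎ (u ≡ x × F v) ⊎ (v ≡ x × F u))
  where

  OutOf : Rel (Fin n) 0ℓ
  OutOf u v = u ≡ x × F v

  outOf? : B.Decidable OutOf
  outOf? u v = (u Finₚ.≟ x) ×-dec F? v

  outOf-asym : ∀ {u v} → OutOf u v → ¬ OutOf v u
  outOf-asym (refl , _) (refl , Fx) = x∉F Fx

  newColour : Fin n → Fin n → C
  newColour u v with outOf? u v | outOf? v u
  ... | yes _ | _     = β v
  ... | no _  | yes _ = β u
  ... | no _  | no _  = colour κ u v

  newColour-out : ∀ {u v} → OutOf u v → newColour u v ≡ β v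
  newColour-out {u} {v} o with outOf? u v
  ... | yes _ = refl
  ... | no ¬o = ⊥-elim (¬o o)

  newColour-into : ∀ {u v} → OutOf v u → newColour u v ≡ β u
  newColour-into {u} {v} i with outOf? u v | outOf? v u
  ... | yes o | _     = ⊥-elim (outOf-asym o i)
  ... | no _  | yes _ = refl
  ... | no _  | no ¬i = ⊥-elim (¬i i)

  newColour-old : ∀ {u v} → ¬ OutOf u v → ¬ OutOf v u → newColour u v ≡ colour κ u v
  newColour-old {u} {v} ¬o ¬i with outOf? u v | outOf? v u
  ... | yes o | _     = ⊥-elim (¬o o)
  ... | no _  | yes i = ⊥-elim (¬i i)
  ... | no _  | no _  = refl

  data Kind (u v : Fin n) : Set where
    out  : OutOf u v → Kind u v
    into : OutOf v u → Kind u v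
    old  : R u v → ¬ OutOf u v → ¬ OutOf v u → Kind u v

  kind : ∀ {u v} → R′ u v → Kind u v
  kind {u} {v} r with outOf? u v | outOf? v u | R′-split r
  ... | yes o | _     | _             = out o
  ... | no _  | yes i | _             = into i
  ... | no ¬o | no ¬i | inj₁ r′       = old r′ ¬o ¬i
  ... | no ¬o | no _  | inj₂ (inj₁ o) = ⊥-elim (¬o o)
  ... | no _  | no ¬i | inj₂ (inj₂ i) = ⊥-elim (¬i i)

  newColour-sym : ∀ {u v} → R′ u v → newColour u v ≡ newColour v u
  newColour-sym r with kind r
  ... | out o        = trans (newColour-out o) (sym (newColour-into o))
  ... | into i       = trans (newColour-into i) (sym (newColour-out i))
  ... | old r′ ¬o ¬i = trans (newColour-old ¬o ¬i) (trans (colour-sym κ r′) (sym (newColour-old ¬i ¬o)))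

  -- At `x`, new colours are distinct by `β-injective`, and an old edge sharing a new colour would
  -- itself have been recoloured by `F-closed`. At a vertex of `F`, the new colour was missing, and
  -- only one edge received it.
  newColour-proper : ∀ {u v w} → R′ u v → R′ u w → newColour u v ≡ newColour u w → v ≡ w
  newColour-proper {u} {v} {w} r s eq with kind r | kind s
  ... | out o@(refl , Fv) | out o′@(_ , Fw) =
    β-injective Fv Fw (trans (sym (newColour-out o)) (trans eq (newColour-out o′)))
  ... | out o@(refl , Fv) | old s′ ¬o ¬i =
    ⊥-elim (¬o (refl , F-closed Fv s′ (trans (sym (newColour-old ¬o ¬i)) (trans (sym eq) (newColour-out o)))))
  ... | old r′ ¬o ¬i | out o@(refl , Fw) =
    ⊥-elim (¬o (refl , F-closed Fw r′ (trans (sym (newColour-old ¬o ¬i)) (trans eq (newColour-out o)))))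
  ... | into i@(_ , Fu) | old s′ ¬o ¬i =
    ⊥-elim (β-missing Fu s′ (trans (sym (newColour-old ¬o ¬i)) (trans (sym eq) (newColour-into i))))
  ... | old r′ ¬o ¬i | into i@(_ , Fu) =
    ⊥-elim (β-missing Fu r′ (trans (sym (newColour-old ¬o ¬i)) (trans eq (newColour-into i))))
  ... | old r′ ¬o ¬i | old s′ ¬o′ ¬i′ =
    proper κ r′ s′ (trans (sym (newColour-old ¬o ¬i)) (trans eq (newColour-old ¬o′ ¬i′)))
  ... | into (refl , _) | into (refl , _)  = refl
  ... | out (refl , _)  | into (refl , Fx) = ⊥-elim (x∉F Fx)
  ... | into (refl , Fx) | out (refl , _)  = ⊥-elim (x∉F Fx)

  recoloured : EdgeColouring R′ C
  recoloured = record { colour = newColour ; colour-sym = newColour-sym ; proper = newColour-proper }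

module Kempe {q} {R : Rel (Fin n) 0ℓ} (R-sym : Symmetric R) (κ : EdgeColouring R (Fin q)) (a d : Fin q)
  {P : Pred (Fin n) 0ℓ} (P? : Decidable P)
  (P-closed : ∀ {u v} → R u v → colour κ u v ≡ a ⊎ colour κ u v ≡ d → P u → P v)
  where

  -- The swap is decided by a single end of the edge. It permutes the colours at each vertex, so
  -- properness is immediate and only symmetry needs an argument.
  swapAt : Fin n → Fin q → Fin q
  swapAt u c with P? u
  ... | yes _ = transpose a d c
  ... | no _  = c

  swapAt-in : ∀ {u} c → P u → swapAt u c ≡ transpose a d c
  swapAt-in {u} c u∈P with P? u
  ... | yes _  = refl
  ... | no u∉P = ⊥-elim (u∉P u∈P)

  swapAt-out : ∀ {u} c → ¬ P u → swapAt u c ≡ c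
  swapAt-out {u} c u∉P with P? u
  ... | yes u∈P = ⊥-elim (u∉P u∈P)
  ... | no _    = refl

  swapAt-other : ∀ u {c} → c ≢ a → c ≢ d → swapAt u c ≡ c
  swapAt-other u c≢a c≢d with P? u
  ... | yes _ = transpose-mismatch a d c≢a c≢d
  ... | no _  = refl

  swapAt-injective : ∀ u {c e} → swapAt u c ≡ swapAt u e → c ≡ e
  swapAt-injective u eq with P? u
  ... | yes _ = transpose-injective a d eq
  ... | no _  = eq

  swapAt-agree : ∀ {u v} → R u v → colour κ u v ≡ a ⊎ colour κ u v ≡ d →
                 swapAt u (colour κ u v) ≡ swapAt v (colour κ u v)
  swapAt-agree {u} {v} r c with P? u | P? v
  ... | yes _   | yes _   = refl
  ... | yes u∈P | no v∉P  = ⊥-elim (v∉P (P-closed r c u∈P))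
  ... | no u∉P  | yes v∈P =
    ⊥-elim (u∉P (P-closed (R-sym r) (subst (λ e → e ≡ a ⊎ e ≡ d) (colour-sym κ r) c) v∈P))
  ... | no _    | no _    = refl

  -- An edge coloured `a` or `d` has both ends in `P` or both outside; every other colour is fixed
  -- by the transposition.
  swap-sym : ∀ {u v} → R u v → swapAt u (colour κ u v) ≡ swapAt v (colour κ u v)
  swap-sym {u} {v} r with colour κ u v Finₚ.≟ a | colour κ u v Finₚ.≟ d
  ... | no c≢a  | no c≢d  = trans (swapAt-other u c≢a c≢d) (sym (swapAt-other v c≢a c≢d))
  ... | yes c≡a | _       = swapAt-agree r (inj₁ c≡a)
  ... | no _    | yes c≡d = swapAt-agree r (inj₂ c≡d)

  swapped : EdgeColouring R (Fin q)
  swapped = record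
    { colour     = λ u v → swapAt u (colour κ u v)
    ; colour-sym = λ {u} {v} r → trans (swap-sym r) (cong (swapAt v) (colour-sym κ r))
    ; proper     = λ {u} r s eq → proper κ r s (swapAt-injective u eq)
    }

-- Colour classes, fans and Kempe components

module Partners {R : Rel (Fin n) 0ℓ} (R? : B.Decidable R) (R-sym : Symmetric R)
  {q} (κ : EdgeColouring R (Fin q)) where

  _appearsAt_ : Fin q → Fin n → Set
  c appearsAt u = ∃[ v ] R u v × colour κ u v ≡ c

  _appearsAt?_ : ∀ c u → Dec (c appearsAt u)
  c appearsAt? u = Finₚ.any? λ v → R? u v ×-dec (colour κ u v Finₚ.≟ c)

  -- A colour class is a matching, encoded as an involution fixing the vertices that miss the
  -- colour. The orbits of two such involutions are the Kempe components.
  partner : Fin q → Fin n → Fin n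
  partner c u with c appearsAt? u
  ... | yes (v , _) = v
  ... | no _        = u

  partner-missing : ∀ {c u} → ¬ c appearsAt u → partner c u ≡ u
  partner-missing {c} {u} ¬c with c appearsAt? u
  ... | yes c-here = ⊥-elim (¬c c-here)
  ... | no _       = refl

  partner-appears : ∀ {c u} → c appearsAt u → R u (partner c u) × colour κ u (partner c u) ≡ c
  partner-appears {c} {u} c-here with c appearsAt? u
  ... | yes (_ , r , eq) = r , eq
  ... | no ¬c            = ⊥-elim (¬c c-here)

  partner-unique : ∀ {c u v} → R u v → colour κ u v ≡ c → partner c u ≡ v
  partner-unique r eq with r′ , eq′ ← partner-appears (_ , r , eq) =
    proper κ r′ r (trans eq′ (sym eq))

  partner-involutive : ∀ c u → partner c (partner c u) ≡ u
  partner-involutive c u = case c appearsAt? u of λ where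
    (yes c-here) → let r , eq = partner-appears c-here in
                   partner-unique (R-sym r) (trans (sym (colour-sym κ r)) eq)
    (no ¬c)      → trans (cong (partner c) (partner-missing ¬c)) (partner-missing ¬c)

  -- Ranging over all relations contained in `R` plus the edge `xy` avoids fixing one representation
  -- of the enlarged graph.
  Extension : Fin n → Fin n → Set₁
  Extension x y = ∀ {R′ : Rel (Fin n) 0ℓ} →
    (∀ {u v} → R′ u v → R u v ⊎ (u ≡ x × v ≡ y) ⊎ (v ≡ x × u ≡ y)) →
    EdgeColouring R′ (Fin q)

module Fan {R : Rel (Fin n) 0ℓ} (R? : B.Decidable R) (R-sym : Symmetric R)
  {q} (κ : EdgeColouring R (Fin q))
  (β : Fin n → Fin q) (β-absent : ∀ u → ¬ Partners._appearsAt_ R? R-sym κ (β u) u)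
  (x : Fin n) (y : ℕ → Fin n) (j : ℕ)
  (spoke : ∀ {l} → l < j → R x (y (suc l)) × colour κ x (y (suc l)) ≡ β (y l))
  (β-distinct : ∀ {k l} → k < j → l < j → β (y k) ≡ β (y l) → k ≡ l)
  (y≢x : ∀ {l} → l ≤ j → y l ≢ x) (uncoloured : ¬ R x (y 0))
  where

  open Partners R? R-sym κ

  β-missing : ∀ {u v} → R u v → colour κ u v ≢ β u
  β-missing {u} r eq = β-absent u (_ , r , eq)

  -- Spokes of different colours have different ends, and `y 0` ends no spoke because its edge to
  -- `x` is uncoloured.
  y-distinct : ∀ {k l} → k < l → l ≤ j → y k ≢ y l
  y-distinct {zero}  {suc l} _ l<j eq = uncoloured (subst (R x) (sym eq) (proj₁ (spoke l<j)))
  y-distinct {suc k} {suc l} (s≤s k<l) l<j eq = <⇒≢ k<l (β-distinct k<j l<j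
    (trans (sym (proj₂ (spoke k<j))) (trans (cong (colour κ x) eq) (proj₂ (spoke l<j)))))
    where k<j = <-trans k<l l<j

  InFan : ℕ → Pred (Fin n) 0ℓ
  InFan t v = ∃[ l ] l < suc t × y l ≡ v

  inFan? : ∀ t → Decidable (InFan t)
  inFan? t v = anyUpTo? (λ l → y l Finₚ.≟ v) (suc t)

  x∉Fan : ∀ {t} → t ≤ j → ¬ InFan t x
  x∉Fan t≤j (l , s≤s l≤t , eq) = y≢x (≤-trans l≤t t≤j) eq

  next-spoke : ∀ {l z} → l < j → R x z → colour κ x z ≡ β (y l) → y (suc l) ≡ z
  next-spoke l<j r eq = proper κ (proj₁ (spoke l<j)) r (trans (proj₂ (spoke l<j)) (sym eq))

  via-fan : ∀ {t} {R′ : Rel (Fin n) 0ℓ} →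
    (∀ {u v} → R′ u v → R u v ⊎ (u ≡ x × v ≡ y 0) ⊎ (v ≡ x × u ≡ y 0)) →
    ∀ {u v} → R′ u v → R u v ⊎ (u ≡ x × InFan t v) ⊎ (v ≡ x × InFan t u)
  via-fan R′-split r with R′-split r
  ... | inj₁ r′                  = inj₁ r′
  ... | inj₂ (inj₁ (eq , refl))  = inj₂ (inj₁ (eq , 0 , s≤s z≤n , refl))
  ... | inj₂ (inj₂ (eq , refl))  = inj₂ (inj₂ (eq , 0 , s≤s z≤n , refl))

  -- The colours `β (y l)` with `l < j` appear at `x` and `β (y j)` does not, so all are distinct.
  -- The edge at `x` of colour `β (y l)` is the next spoke, which is recoloured as well.
  rotate : ¬ β (y j) appearsAt x → Extension x (y 0)
  rotate free R′-split = recoloured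
    where
    injective : ∀ {k l} → k ≤ j → l ≤ j → β (y k) ≡ β (y l) → k ≡ l
    injective k≤j l≤j eq with m≤n⇒m<n∨m≡n k≤j | m≤n⇒m<n∨m≡n l≤j
    ... | inj₁ k<j  | inj₁ l<j  = β-distinct k<j l<j eq
    ... | inj₁ k<j  | inj₂ refl = ⊥-elim (free (_ , proj₁ (spoke k<j) , trans (proj₂ (spoke k<j)) eq))
    ... | inj₂ refl | inj₁ l<j  = ⊥-elim (free (_ , proj₁ (spoke l<j) , trans (proj₂ (spoke l<j)) (sym eq)))
    ... | inj₂ refl | inj₂ refl = refl
    β-injective : ∀ {u v} → InFan j u → InFan j v → β u ≡ β v → u ≡ v
    β-injective (k , s≤s k≤j , refl) (l , s≤s l≤j , refl) eq = cong y (injective k≤j l≤j eq)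
    closed : ∀ {v z} → InFan j v → R x z → colour κ x z ≡ β v → InFan j z
    closed (l , s≤s l≤j , refl) r eq with m≤n⇒m<n∨m≡n l≤j
    ... | inj₁ l<j  = suc l , s≤s l<j , next-spoke l<j r eq
    ... | inj₂ refl = ⊥-elim (free (_ , r , eq))
    open Recolour κ x (inFan? j) (x∉Fan ≤-refl) β (λ _ → β-missing) β-injective closed (via-fan R′-split)

  -- The first colour appears at `x` on the next spoke, and the second is missing at `x`.
  β≢βx : ∀ {l} → l < j → β (y l) ≢ β x
  β≢βx l<j eq = β-missing (proj₁ (spoke l<j)) (trans (proj₂ (spoke l<j)) eq)

  module _ {d : Fin q} {P : Pred (Fin n) 0ℓ} (P? : Decidable P)
    (P-closed : ∀ {u v} → R u v → colour κ u v ≡ β x ⊎ colour κ u v ≡ d → P u → P v) (x∈P : P x) where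

    private
      a = β x

    open Kempe R-sym κ a d P? P-closed

    -- After the swap `d` is missing at `x`, which lies in `P`, and still missing at `y t`, which
    -- does not. The condition on earlier vertices keeps the fan up to `y t` intact, so it can be
    -- rotated with top colour `d`.
    swap-and-rotate : ∀ {t} → t ≤ j → ¬ P (y t) → β (y t) ≡ d →
      (∀ {l} → l < t → β (y l) ≢ d ⊎ P (y l)) → Extension x (y 0)
    swap-and-rotate {t} t≤j yₜ∉ βt≡d earlier R′-split = recoloured
      where
      γ : Fin n → Fin q
      γ u = swapAt u (β u)
      γ-top : γ (y t) ≡ d
      γ-top = trans (swapAt-out _ yₜ∉) βt≡d
      -- Every colour at `x` is transposed; the missing colours of the earlier fan vertices follow
      -- the colours of their next spokes.
      γ-below : ∀ {l} → l < t → transpose a d (γ (y l)) ≡ β (y l)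
      γ-below {l} l<t with β (y l) Finₚ.≟ d | earlier l<t
      ... | no ≢d  | _         = trans (cong (transpose a d) (swapAt-other (y l) ≢a ≢d)) (transpose-mismatch a d ≢a ≢d)
        where ≢a = β≢βx (<-≤-trans l<t t≤j)
      ... | yes ≡d | inj₁ ≢d   = ⊥-elim (≢d ≡d)
      ... | yes ≡d | inj₂ yₗ∈  =
        trans (cong (transpose a d) (trans (swapAt-in _ yₗ∈) (trans (cong (transpose a d) ≡d) (transpose-matchʳ a d))))
        (trans (transpose-matchˡ a d) (sym ≡d))
      γ-below≢d : ∀ {l} → l < t → γ (y l) ≢ d
      γ-below≢d l<t eq = β≢βx (<-≤-trans l<t t≤j)
        (trans (sym (γ-below l<t)) (trans (cong (transpose a d) eq) (transpose-matchʳ a d)))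
      injective : ∀ {k l} → k ≤ t → l ≤ t → γ (y k) ≡ γ (y l) → k ≡ l
      injective k≤t l≤t eq with m≤n⇒m<n∨m≡n k≤t | m≤n⇒m<n∨m≡n l≤t
      ... | inj₁ k<t  | inj₁ l<t  = β-distinct (<-≤-trans k<t t≤j) (<-≤-trans l<t t≤j)
        (trans (sym (γ-below k<t)) (trans (cong (transpose a d) eq) (γ-below l<t)))
      ... | inj₁ k<t  | inj₂ refl = ⊥-elim (γ-below≢d k<t (trans eq γ-top))
      ... | inj₂ refl | inj₁ l<t  = ⊥-elim (γ-below≢d l<t (trans (sym eq) γ-top))
      ... | inj₂ refl | inj₂ refl = refl
      γ-injective : ∀ {u v} → InFan t u → InFan t v → γ u ≡ γ v → u ≡ v
      γ-injective (k , s≤s k≤t , refl) (l , s≤s l≤t , refl) eq = cong y (injective k≤t l≤t eq)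
      old-colour : ∀ {z c} → swapAt x (colour κ x z) ≡ c → colour κ x z ≡ transpose a d c
      old-colour eq = transpose-injective a d
        (trans (sym (swapAt-in _ x∈P)) (trans eq (sym (transpose-involutive a d))))
      closed : ∀ {v z} → InFan t v → R x z → swapAt x (colour κ x z) ≡ γ v → InFan t z
      closed (l , s≤s l≤t , refl) r eq with m≤n⇒m<n∨m≡n l≤t
      ... | inj₁ l<t  = suc l , s≤s l<t , next-spoke (<-≤-trans l<t t≤j) r (trans (old-colour eq) (γ-below l<t))
      ... | inj₂ refl = ⊥-elim (β-missing r (trans (old-colour (trans eq γ-top)) (transpose-matchʳ a d)))
      γ-missing : ∀ {u v} → InFan t u → R u v → swapAt u (colour κ u v) ≢ γ u
      γ-missing {u} _ r eq = β-missing r (swapAt-injective u eq)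
      open Recolour swapped x (inFan? t) (x∉Fan t≤j) γ γ-missing γ-injective closed (via-fan R′-split)

    -- If `y i` lies outside `P`, the fan is cut at `y i`, before which no missing colour is `d`.
    -- Otherwise `y j` lies outside, and the only earlier vertex with missing colour `d` is `y i`,
    -- which is in `P`.
    extend-by-swap : ∀ {i} → i < j → β (y i) ≡ β (y j) → β (y j) ≡ d → (P (y i) → ¬ P (y j)) → Extension x (y 0)
    extend-by-swap {i} i<j repeat βj≡d not-both with P? (y i)
    ... | no yᵢ∉  = swap-and-rotate (<⇒≤ i<j) yᵢ∉ (trans repeat βj≡d) λ l<i → inj₁ λ eq →
      <⇒≢ l<i (β-distinct (<-trans l<i i<j) i<j (trans eq (sym (trans repeat βj≡d))))
    ... | yes yᵢ∈ = swap-and-rotate ≤-refl (not-both yᵢ∈) βj≡d earlier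
      where
      earlier : ∀ {l} → l < j → β (y l) ≢ d ⊎ P (y l)
      earlier {l} l<j with β (y l) Finₚ.≟ d
      ... | no ≢d  = inj₁ ≢d
      ... | yes ≡d = inj₂ (subst (P ∘ y) (β-distinct i<j l<j (trans repeat (trans βj≡d (sym ≡d)))) yᵢ∈)

  module Repeated {i} (i<j : i < j) (repeat : β (y i) ≡ β (y j)) where

    a d : Fin q
    a = β x
    d = β (y j)

    -- `x` misses `a`, so it is the fixed point of the first involution that `Orbit` starts from.
    open Orbit (partner a) (partner d) (partner-involutive a) (partner-involutive d)
               x (partner-missing (β-absent x)) public

    orbit-closed : ∀ {u v} → R u v → colour κ u v ≡ a ⊎ colour κ u v ≡ d → InOrbit u → InOrbit v
    orbit-closed r (inj₁ eq) u∈ = subst InOrbit (partner-unique r eq) (f-closed u∈)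
    orbit-closed r (inj₂ eq) u∈ = subst InOrbit (partner-unique r eq) (g-closed u∈)

    yᵢ-endpoint : Endpoint (y i)
    yᵢ-endpoint = inj₂ (subst (λ c → partner c (y i) ≡ y i) repeat (partner-missing (β-absent (y i))))

    yⱼ-endpoint : Endpoint (y j)
    yⱼ-endpoint = inj₂ (partner-missing (β-absent (y j)))

    extension : Extension x (y 0)
    extension = extend-by-swap inOrbit? orbit-closed x∈ i<j repeat refl
      (one-endpoint (y≢x (<⇒≤ i<j)) (y≢x ≤-refl) (y-distinct i<j ≤-refl) yᵢ-endpoint yⱼ-endpoint)

-- Adding the edges one at a time

module Extend {A R : Rel (Fin n) 0ℓ} (A? : B.Decidable A) (A-irrefl : ∀ {u} → ¬ A u u)
  {D : ℕ} (deg≤D : ∀ u → length (neighbours A? u) ≤ D)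
  (R? : B.Decidable R) (R-sym : Symmetric R) (R⊆A : ∀ {u v} → R u v → A u v)
  (κ : EdgeColouring R (Fin (suc D)))
  where

  open Partners R? R-sym κ

  -- If all `suc D` colours appeared at `u`, edges of different colours would lead to `suc D`
  -- different neighbours.
  some-missing : ∀ u → ∃[ c ] ¬ c appearsAt u
  some-missing u = Finₚ.¬∀⟶∃¬ _ _ (_appearsAt? u) λ all → 1+n≰n (≤-trans (bound all) (deg≤D u))
    where
    bound : (∀ c → c appearsAt u) → suc D ≤ length (neighbours A? u)
    bound all = subst (_≤ length (neighbours A? u)) (length-tabulate id)
      (injection⇒length≤ (proj₁ ∘ all) (Uniqueₚ.allFin⁺ (suc D))
        (λ {c} _ → ∈-filter⁺ (A? u) (∈-allFin _) (R⊆A (proj₁ (proj₂ (all c)))))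
        (λ {c} {e} _ _ eq → trans (sym (proj₂ (proj₂ (all c))))
                            (trans (cong (colour κ u) eq) (proj₂ (proj₂ (all e))))))

  module _ (β : Fin n → Fin (suc D)) (β-absent : ∀ u → ¬ β u appearsAt u)
    {x y₀ : Fin n} (x~y₀ : A x y₀) (uncoloured : ¬ R x y₀) where

    -- Once `β (y l)` is missing at `x`, `partner` returns its default `x`; the fan is read only up
    -- to the first such index.
    y : ℕ → Fin n
    y zero    = y₀
    y (suc l) = partner (β (y l)) x

    Stop : Pred ℕ 0ℓ
    Stop j = ¬ β (y j) appearsAt x ⊎ ∃[ i ] i < j × β (y i) ≡ β (y j)

    stop? : Decidable Stop
    stop? j = ¬? (β (y j) appearsAt? x) ⊎-dec anyUpTo? (λ i → β (y i) Finₚ.≟ β (y j)) j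

    stops : ∃ Stop
    -- `suc (suc D)` indices share `suc D` colours, so a repetition occurs if nothing stops the fan
    -- earlier.
    stops = let i , j , i<j , eq = Finₚ.pigeonhole (n<1+n (suc D)) (β ∘ y ∘ toℕ) in
      toℕ j , inj₂ (toℕ i , i<j , eq)

    -- That no earlier index stops gives both fan hypotheses: each spoke exists, and no colour
    -- repeats.
    module _ {j : ℕ} (before : ∀ l → l < j → ¬ Stop l) where

      spoke : ∀ {l} → l < j → R x (y (suc l)) × colour κ x (y (suc l)) ≡ β (y l)
      spoke {l} l<j = partner-appears (decidable-stable (_ appearsAt? x) (before l l<j ∘ inj₁))

      β-distinct : ∀ {k l} → k < j → l < j → β (y k) ≡ β (y l) → k ≡ l
      β-distinct {k} {l} k<j l<j eq with <-cmp k l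
      ... | tri< k<l _ _ = ⊥-elim (before l l<j (inj₂ (k , k<l , eq)))
      ... | tri≈ _ k≡l _ = k≡l
      ... | tri> _ _ l<k = ⊥-elim (before k k<j (inj₂ (l , l<k , sym eq)))

      y≢x : ∀ {l} → l ≤ j → y l ≢ x
      y≢x {zero}  _   eq = A-irrefl (subst (A x) eq x~y₀)
      y≢x {suc l} l<j eq = A-irrefl (subst (A x) eq (R⊆A (proj₁ (spoke l<j))))

      open Fan R? R-sym κ β β-absent x y j spoke β-distinct y≢x uncoloured

      extend-at : Stop j → Extension x y₀
      extend-at (inj₁ free)               = rotate free
      extend-at (inj₂ (i , i<j , repeat)) = Repeated.extension i<j repeat

    extend-from : Extension x y₀
    extend-from = let j , _ , stop-j , before = least stop? (proj₁ stops) (proj₂ stops) in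
      extend-at before stop-j

  extend : ∀ {x y₀} → A x y₀ → ¬ R x y₀ → Extension x y₀
  extend = extend-from (proj₁ ∘ some-missing) (proj₂ ∘ some-missing)

module _ {A : Rel (Fin n) 0ℓ} (A? : B.Decidable A) (A-sym : Symmetric A) (A-irrefl : ∀ {u} → ¬ A u u)
  {D : ℕ} (deg≤D : ∀ u → length (neighbours A? u) ≤ D) where

  open DecMembership (≡-dec (Finₚ._≟_ {n}) (Finₚ._≟_ {n})) using (_∈?_)

  Among : List (Fin n × Fin n) → Rel (Fin n) 0ℓ
  Among L u v = A u v × ((u , v) ∈ L ⊎ (v , u) ∈ L)

  among? : ∀ L → B.Decidable (Among L)
  among? L u v = A? u v ×-dec (((u , v) ∈? L) ⊎-dec ((v , u) ∈? L))

  among-sym : ∀ L → Symmetric (Among L)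
  among-sym L (a , inj₁ uv) = A-sym a , inj₂ uv
  among-sym L (a , inj₂ vu) = A-sym a , inj₁ vu

  colour-among : ∀ L → EdgeColouring (Among L) (Fin (suc D))
  colour-among [] = record
    { colour     = λ _ _ → Fin.zero
    ; colour-sym = λ _ → refl
    ; proper     = λ { (_ , inj₁ ()) ; (_ , inj₂ ()) }
    }
  colour-among ((x , y) ∷ L) with A? x y ×-dec ¬? (among? L x y)
  ... | yes (x~y , new) = Extend.extend A? A-irrefl deg≤D (among? L) (among-sym L) proj₁
                            (colour-among L) x~y new split
    where
    split : ∀ {u v} → Among ((x , y) ∷ L) u v → Among L u v ⊎ (u ≡ x × v ≡ y) ⊎ (v ≡ x × u ≡ y)
    split (a , inj₁ (here refl)) = inj₂ (inj₁ (refl , refl))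
    split (a , inj₂ (here refl)) = inj₂ (inj₂ (refl , refl))
    split (a , inj₁ (there uv))  = inj₁ (a , inj₁ uv)
    split (a , inj₂ (there vu))  = inj₁ (a , inj₂ vu)
  -- The pair is not an edge or is already coloured, so the relation does not grow.
  ... | no ¬new = restrict old (colour-among L)
    where
    xy-old : A x y → Among L x y
    xy-old x~y = decidable-stable (among? L x y) λ ¬old → ¬new (x~y , ¬old)
    old : ∀ {u v} → Among ((x , y) ∷ L) u v → Among L u v
    old (a , inj₁ (here refl)) = xy-old a
    old (a , inj₂ (here refl)) = among-sym L (xy-old (A-sym a))
    old (a , inj₁ (there uv))  = a , inj₁ uv
    old (a , inj₂ (there vu))  = a , inj₂ vu

  vizing : EdgeColouring A (Fin (suc D))
  vizing = restrict (λ {u} {v} a → a , inj₁ (∈-cartesianProduct⁺ (∈-allFin u) (∈-allFin v)))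
                    (colour-among (cartesianProduct (allFin n) (allFin n)))

-- Counting edges

SameEdge : (u v x y : Fin n) → Set
SameEdge u v x y = (u ≡ x × v ≡ y) ⊎ (u ≡ y × v ≡ x)

-- An embedding need not preserve the order of vertices; sorting its image pairs returns them to the
-- listed form of edges.
sort : Fin n → Fin n → Fin n × Fin n
sort u v with u Fin.<? v
... | yes _ = u , v
... | no _  = v , u

sort-injective : ∀ {u v x y : Fin n} → sort u v ≡ sort x y → SameEdge u v x y
sort-injective {u = u} {v} {x} {y} eq with u Fin.<? v | x Fin.<? y | eq
... | yes _ | yes _ | refl = inj₁ (refl , refl)
... | yes _ | no _  | refl = inj₂ (refl , refl)
... | no _  | yes _ | refl = inj₂ (refl , refl)
... | no _  | no _  | refl = inj₁ (refl , refl)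

sameEdge-sorted : ∀ {u v x y : Fin n} → u Fin.< v → x Fin.< y → SameEdge u v x y → (u , v) ≡ (x , y)
sameEdge-sorted _   _   (inj₁ (refl , refl)) = refl
sameEdge-sorted u<v x<y (inj₂ (refl , refl)) = ⊥-elim (<-asym u<v x<y)

IsEdge : Rel (Fin n) 0ℓ → Pred (Fin n × Fin n) 0ℓ
IsEdge R (u , v) = u Fin.< v × R u v

isEdge? : {R : Rel (Fin n) 0ℓ} → B.Decidable R → Decidable (IsEdge R)
isEdge? R? (u , v) = (u Fin.<? v) ×-dec R? u v

-- On the adjacency relation of a graph this computes to `edges`, so bounds on it are bounds on
-- `numEdges`.
edgesOf : {R : Rel (Fin n) 0ℓ} → B.Decidable R → List (Fin n × Fin n)
edgesOf R? = filter (isEdge? R?) (cartesianProduct (allFin _) (allFin _))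

module _ {R : Rel (Fin n) 0ℓ} (R? : B.Decidable R) where

  edgesOf-unique : Unique (edgesOf R?)
  edgesOf-unique = Uniqueₚ.filter⁺ (isEdge? R?) (Uniqueₚ.cartesianProduct⁺ (Uniqueₚ.allFin⁺ n) (Uniqueₚ.allFin⁺ n))

  ∈-edgesOf⁺ : ∀ {u v} → u Fin.< v → R u v → (u , v) ∈ edgesOf R?
  ∈-edgesOf⁺ u<v r = ∈-filter⁺ (isEdge? R?) (∈-cartesianProduct⁺ (∈-allFin _) (∈-allFin _)) (u<v , r)

  ∈-edgesOf⁻ : ∀ {u v} → (u , v) ∈ edgesOf R? → u Fin.< v × R u v
  ∈-edgesOf⁻ uv∈ = proj₂ (∈-filter⁻ (isEdge? R?) {xs = cartesianProduct (allFin n) (allFin n)} uv∈)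

  sort-∈-edgesOf : Symmetric R → ∀ {u v} → R u v → u ≢ v → sort u v ∈ edgesOf R?
  sort-∈-edgesOf R-sym {u} {v} r u≢v with u Fin.<? v
  ... | yes u<v = ∈-edgesOf⁺ u<v r
  ... | no u≮v  = ∈-edgesOf⁺ (Finₚ.≤∧≢⇒< (≮⇒≥ u≮v) (u≢v ∘ sym)) (R-sym r)

infixl 6 _∩_ _∖_ _∩?_ _∖?_

_∩_ _∖_ : Rel (Fin n) 0ℓ → Rel (Fin n) 0ℓ → Rel (Fin n) 0ℓ
(R ∩ D) u v = R u v × D u v
(R ∖ D) u v = R u v × ¬ D u v

_∩?_ : {R D : Rel (Fin n) 0ℓ} → B.Decidable R → B.Decidable D → B.Decidable (R ∩ D)
(R? ∩? D?) u v = R? u v ×-dec D? u v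

_∖?_ : {R D : Rel (Fin n) 0ℓ} → B.Decidable R → B.Decidable D → B.Decidable (R ∖ D)
(R? ∖? D?) u v = R? u v ×-dec ¬? (D? u v)

length-edgesOf-split : {R D : Rel (Fin n) 0ℓ} (R? : B.Decidable R) (D? : B.Decidable D) →
  length (edgesOf R?) ≡ length (edgesOf (R? ∩? D?)) + length (edgesOf (R? ∖? D?))
length-edgesOf-split {R = R} {D} R? D? = length-filter-split
  {P = IsEdge R} {Q = IsEdge (R ∩ D)} {R = IsEdge (R ∖ D)} (isEdge? R?) (isEdge? (R? ∩? D?)) (isEdge? (R? ∖? D?))
  (λ {(u , v)} (u<v , r) → case D? u v of λ where
    (yes d) → inj₁ (u<v , r , d)
    (no ¬d) → inj₂ (u<v , r , ¬d))
  (λ (u<v , r , _) → u<v , r) (λ (u<v , r , _) → u<v , r) (λ (_ , _ , d) (_ , _ , ¬d) → ¬d d)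
  (cartesianProduct (allFin _) (allFin _))

-- Forcing rainbow partial copies

mapColours : ∀ {C′} {R : Rel (Fin n) 0ℓ} (f : C → C′) → Injective _≡_ _≡_ f → EdgeColouring R C → EdgeColouring R C′
mapColours f f-inj κ = record
  { colour     = λ u v → f (colour κ u v)
  ; colour-sym = cong f ∘ colour-sym κ
  ; proper     = λ r s eq → proper κ r s (f-inj eq)
  }

-- Shifting the colours of `κ` by `N` makes them disjoint from those of `δ`, so two edges of equal
-- colour lie both in `D` or both outside.
module Overlay {R D : Rel (Fin n) 0ℓ} (D? : B.Decidable D) (D-sym : Symmetric D) (N : ℕ)
  (δ : EdgeColouring (R ∩ D) ℕ) (δ<N : ∀ {u v} → R u v → D u v → colour δ u v < N)
  (κ : EdgeColouring (R ∖ D) ℕ) where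

  mixed : Fin n → Fin n → ℕ
  mixed u v with D? u v
  ... | yes _ = colour δ u v
  ... | no _  = N + colour κ u v

  mixed-in : ∀ {u v} → D u v → mixed u v ≡ colour δ u v
  mixed-in {u} {v} d with D? u v
  ... | yes _ = refl
  ... | no ¬d = ⊥-elim (¬d d)

  mixed-out : ∀ {u v} → ¬ D u v → mixed u v ≡ N + colour κ u v
  mixed-out {u} {v} ¬d with D? u v
  ... | yes d = ⊥-elim (¬d d)
  ... | no _  = refl

  separate : ∀ {u v x y} → R u v → D u v → ¬ D x y → mixed u v ≢ mixed x y
  separate r d ¬d eq = <⇒≱ (δ<N r d)
    (subst (N ≤_) (trans (sym (mixed-out ¬d)) (trans (sym eq) (mixed-in d))) (m≤m+n N _))

  mixed-sym : ∀ {u v} → R u v → mixed u v ≡ mixed v u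
  mixed-sym {u} {v} r = case D? u v of λ where
    (yes d) → trans (mixed-in d) (trans (colour-sym δ (r , d)) (sym (mixed-in (D-sym d))))
    (no ¬d) → trans (mixed-out ¬d) (trans (cong (N +_) (colour-sym κ (r , ¬d))) (sym (mixed-out (¬d ∘ D-sym))))

  mixed-proper : ∀ {u v w} → R u v → R u w → mixed u v ≡ mixed u w → v ≡ w
  mixed-proper {u} {v} {w} r s eq = case (D? u v , D? u w) of λ where
    (yes d , yes e) → proper δ (r , d) (s , e) (trans (sym (mixed-in d)) (trans eq (mixed-in e)))
    (no ¬d , no ¬e) → proper κ (r , ¬d) (s , ¬e)
      (+-cancelˡ-≡ N _ _ (trans (sym (mixed-out ¬d)) (trans eq (mixed-out ¬e))))
    (yes d , no ¬e) → ⊥-elim (separate r d ¬e eq)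
    (no ¬d , yes e) → ⊥-elim (separate s e ¬d (sym eq))

  mixture : EdgeColouring R ℕ
  mixture = record { colour = mixed ; colour-sym = mixed-sym ; proper = mixed-proper }

module Forcing (H : Graph) where

  -- All vertices of `H` are placed, but only the edges in `Part` must be present in the host.
  -- Deleting host edges then shrinks `Part` alone.
  record PartialCopy {n} (A : Rel (Fin n) 0ℓ) : Set₁ where
    field
      vertex    : Vertex H → Fin n
      injective : Injective _≡_ _≡_ vertex
      Part      : Rel (Vertex H) 0ℓ
      part?     : B.Decidable Part
      part-sym  : Symmetric Part
      part⊆H    : ∀ {u v} → Part u v → Adj H u v
      image     : ∀ {u v} → Part u v → A (vertex u) (vertex v)

    size : ℕ
    size = length (edgesOf part?)

    Pullback : Rel (Fin n) 0ℓ → Rel (Vertex H) 0ℓ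
    Pullback D u v = D (vertex u) (vertex v)

    pullback? : ∀ {D} → B.Decidable D → B.Decidable (Pullback D)
    pullback? D? u v = D? (vertex u) (vertex v)

    RainbowOn : Rel (Fin n) 0ℓ → (Fin n → Fin n → ℕ) → Set
    RainbowOn D c = ∀ {u v x y} → Part u v → Part x y → Pullback D u v → Pullback D x y →
      c (vertex u) (vertex v) ≡ c (vertex x) (vertex y) → SameEdge u v x y

  open PartialCopy

  Forces : Rel (Fin n) 0ℓ → ℕ → Set₁
  Forces {n} A m = (κ : EdgeColouring A ℕ) →
    Σ[ p ∈ PartialCopy A ] RainbowOn p (λ _ _ → ⊤) (colour κ) × m ≤ size p

  -- A colouring of the remaining edges is completed by `δ` in fresh colours. The resulting rainbow
  -- partial copy stays rainbow when its edges in `D` are dropped, and `loss` bounds their number.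
  forces-delete : {A D : Rel (Fin n) 0ℓ} (D? : B.Decidable D) → Symmetric D → ∀ N
    (δ : EdgeColouring (A ∩ D) ℕ) → (∀ {u v} → A u v → D u v → colour δ u v < N) → ∀ {l} →
    (∀ (p : PartialCopy A) → RainbowOn p D (colour δ) → length (edgesOf (part? p ∩? pullback? p D?)) ≤ l) →
    ∀ {m} → Forces A m → Forces (A ∖ D) (m ∸ l)
  forces-delete {A = A} {D} D? D-sym N δ δ<N {l} loss {m} forces κ with forces (Overlay.mixture D? D-sym N δ δ<N κ)
  ... | p , rainbow , m≤size = remainder , remainder-rainbow , m≤n+o⇒m∸n≤o m l
          (≤-trans m≤size (≤-trans (≤-reflexive (length-edgesOf-split (part? p) (pullback? p D?)))
                                   (+-monoˡ-≤ _ (loss p lost-rainbow))))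
    where
    open Overlay D? D-sym N δ δ<N κ
    remainder : PartialCopy (A ∖ D)
    remainder = record
      { vertex    = vertex p
      ; injective = injective p
      ; Part      = Part p ∖ Pullback p D
      ; part?     = part? p ∖? pullback? p D?
      ; part-sym  = λ (b , ¬d) → part-sym p b , ¬d ∘ D-sym
      ; part⊆H    = λ (b , _) → part⊆H p b
      ; image     = λ (b , ¬d) → image p b , ¬d
      }
    remainder-rainbow : RainbowOn remainder (λ _ _ → ⊤) (colour κ)
    remainder-rainbow (b , ¬d) (b′ , ¬d′) _ _ eq =
      rainbow b b′ tt tt (trans (mixed-out ¬d) (trans (cong (N +_) eq) (sym (mixed-out ¬d′))))
    lost-rainbow : RainbowOn p D (colour δ)
    lost-rainbow b b′ d d′ eq = rainbow b b′ tt tt (trans (mixed-in d) (trans eq (sym (mixed-in d′))))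

  -- The quadratic bound: deleting stars

  module Star {A : Rel (Fin n) 0ℓ} (A? : B.Decidable A) (A-sym : Symmetric A) (A-irrefl : ∀ {u} → ¬ A u u)
    (v : Fin n) where

    AtCentre : Rel (Fin n) 0ℓ
    AtCentre u w = u ≡ v ⊎ w ≡ v

    atCentre? : B.Decidable AtCentre
    atCentre? u w = (u Finₚ.≟ v) ⊎-dec (w Finₚ.≟ v)

    otherEnd : Fin n → Fin n → Fin n
    otherEnd u w with u Finₚ.≟ v
    ... | yes _ = w
    ... | no _  = u

    otherEnd-from : ∀ {w} → otherEnd v w ≡ w
    otherEnd-from with v Finₚ.≟ v
    ... | yes _  = refl
    ... | no v≢v = ⊥-elim (v≢v refl)

    otherEnd-to : ∀ {u} → u ≢ v → otherEnd u v ≡ u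
    otherEnd-to {u} u≢v with u Finₚ.≟ v
    ... | yes u≡v = ⊥-elim (u≢v u≡v)
    ... | no _    = refl

    -- Labelling by the far end separates the edges at `v`, and every other vertex lies on at most
    -- one edge of the star.
    starColouring : EdgeColouring (A ∩ AtCentre) (Fin n)
    starColouring = record
      { colour     = otherEnd
      ; colour-sym = λ where
          (a , inj₁ refl) → trans otherEnd-from (sym (otherEnd-to λ { refl → A-irrefl a }))
          (a , inj₂ refl) → trans (otherEnd-to λ { refl → A-irrefl a }) (sym otherEnd-from)
      ; proper     = λ where
          (_ , inj₁ refl) (_ , inj₁ _)    eq → trans (sym otherEnd-from) (trans eq otherEnd-from)
          (_ , inj₁ refl) (a , inj₂ refl) eq → ⊥-elim (A-irrefl a)
          (a , inj₂ refl) (_ , inj₁ refl) eq → ⊥-elim (A-irrefl a)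
          (_ , inj₂ refl) (_ , inj₂ refl) eq → refl
      }

    degree≤star : length (neighbours A? v) ≤ length (edgesOf (A? ∩? atCentre?))
    degree≤star = injection⇒length≤ (sort v) (Uniqueₚ.filter⁺ (A? v) (Uniqueₚ.allFin⁺ n))
      (λ w∈ → let a = proj₂ (∈-filter⁻ (A? v) {xs = allFin n} w∈) in
        sort-∈-edgesOf (A? ∩? atCentre?) (λ (a , c) → A-sym a , Sum.swap c) (a , inj₁ refl)
          λ { refl → A-irrefl a })
      (λ _ _ eq → case sort-injective eq of λ where
        (inj₁ (_ , w≡w′))       → w≡w′
        (inj₂ (v≡w′ , w≡v)) → trans w≡v v≡w′)

  -- At most one vertex `x` of `H` is placed on `v`; the far ends of the lost edges are then
  -- distinct neighbours of `x` in `H`.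
  star≤degree : ∀ {A : Rel (Fin n) 0ℓ} v (p : PartialCopy A) {Δ} → (∀ x → degree H x ≤ Δ) →
    (atCentre? : B.Decidable (λ u w → u ≡ v ⊎ w ≡ v)) →
    length (edgesOf (part? p ∩? pullback? p atCentre?)) ≤ Δ
  star≤degree v p deg≤Δ atCentre? with Finₚ.any? (λ x → vertex p x Finₚ.≟ v)
  ... | no v∉ = ≤-trans (injection⇒length≤ {ys = []} proj₁ (edgesOf-unique _) (⊥-elim ∘ none) (λ e _ _ → ⊥-elim (none e))) z≤n
    where
    none : ∀ {e} → ¬ e ∈ edgesOf (part? p ∩? pullback? p atCentre?)
    none e∈ = case proj₂ (proj₂ (∈-edgesOf⁻ (part? p ∩? pullback? p atCentre?) e∈)) of λ where
      (inj₁ eq) → v∉ (_ , eq)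
      (inj₂ eq) → v∉ (_ , eq)
  ... | yes (x , refl) = ≤-trans
    (injection⇒length≤ (λ (u , w) → otherEnd u w) (edgesOf-unique _)
      (λ e∈ → let _ , b , c = ∈-edgesOf⁻ B? e∈ in ∈-filter⁺ _ (∈-allFin _) (other-adjacent b (at-x c)))
      (λ e∈ e′∈ eq → let u<w , _ , c = ∈-edgesOf⁻ B? e∈ ; u′<w′ , _ , c′ = ∈-edgesOf⁻ B? e′∈ in
        other-injective u<w u′<w′ (at-x c) (at-x c′) eq))
    (deg≤Δ x)
    where
    B? = part? p ∩? pullback? p atCentre?
    open Star (λ u w → T? (Graph.adj H u w)) (Graph.symmetric H) (Graph.loopless H _) x
      using (otherEnd; otherEnd-from; otherEnd-to)
    at-x : ∀ {u w} → vertex p u ≡ vertex p x ⊎ vertex p w ≡ vertex p x → u ≡ x ⊎ w ≡ x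
    at-x = Sum.map (injective p) (injective p)
    other-adjacent : ∀ {u w} → Part p u w → u ≡ x ⊎ w ≡ x → Adj H x (otherEnd u w)
    other-adjacent b (inj₁ refl) = subst (Adj H x) (sym otherEnd-from) (part⊆H p b)
    other-adjacent {u} b (inj₂ refl) =
      subst (Adj H x) (sym (otherEnd-to λ { refl → Graph.loopless H _ (part⊆H p b) })) (part⊆H p (part-sym p b))
    other-injective : ∀ {u w u′ w′} → u Fin.< w → u′ Fin.< w′ → u ≡ x ⊎ w ≡ x → u′ ≡ x ⊎ w′ ≡ x →
      otherEnd u w ≡ otherEnd u′ w′ → (u , w) ≡ (u′ , w′)
    other-injective _ _ (inj₁ refl) (inj₁ refl) eq =
      cong (x ,_) (trans (sym otherEnd-from) (trans eq otherEnd-from))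
    other-injective u<w u′<w′ (inj₂ refl) (inj₂ refl) eq =
      cong (_, x) (trans (sym (otherEnd-to (Finₚ.<⇒≢ u<w))) (trans eq (otherEnd-to (Finₚ.<⇒≢ u′<w′))))
    -- A common far end would lie both above and below `x`.
    other-injective x<w u′<x (inj₁ refl) (inj₂ refl) eq =
      ⊥-elim (<-asym x<w (subst (Fin._< x) (trans (sym (otherEnd-to (Finₚ.<⇒≢ u′<x))) (trans (sym eq) otherEnd-from)) u′<x))
    other-injective u<x x<w′ (inj₂ refl) (inj₁ refl) eq =
      ⊥-elim (<-asym x<w′ (subst (Fin._< x) (trans (sym (otherEnd-to (Finₚ.<⇒≢ u<x))) (trans eq otherEnd-from)) u<x))

  -- In a colouring by `suc D` colours, which Vizing's theorem provides, a rainbow partial copy has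
  -- at most `suc D` edges.
  degree-bound : ∀ {n D m} {A : Rel (Fin n) 0ℓ} (A? : B.Decidable A) → Symmetric A → (∀ {u} → ¬ A u u) →
    (∀ u → length (neighbours A? u) ≤ D) → Forces A m → m ≤ suc D
  degree-bound {D = D} A? A-sym A-irrefl deg≤D forces
    with κ ← vizing A? A-sym A-irrefl deg≤D
    with p , rainbow , m≤size ← forces (mapColours toℕ Finₚ.toℕ-injective κ) =
    ≤-trans m≤size (subst (size p ≤_) (length-tabulate {n = suc D} id)
      (injection⇒length≤ (λ (u , v) → colour κ (vertex p u) (vertex p v)) (edgesOf-unique (part? p))
        (λ _ → ∈-allFin _)
        (λ e∈ e′∈ eq → let u<v , b = ∈-edgesOf⁻ (part? p) e∈ ; x<y , b′ = ∈-edgesOf⁻ (part? p) e′∈ in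
          sameEdge-sorted u<v x<y (rainbow b b′ tt tt (cong toℕ eq)))))

  -- M = Δ + m′ and s ≥ M give M² = 2 Δ M + m′² − Δ² ≤ 2 Δ s + 2 Δ e′.
  quadratic-step : ∀ Δ m′ {s e′} → Δ + m′ ≤ s → m′ * m′ ≤ 2 * Δ * e′ → (Δ + m′) * (Δ + m′) ≤ 2 * Δ * (s + e′)
  quadratic-step Δ m′ {s} {e′} M≤s ih = begin
    (Δ + m′) * (Δ + m′)                     ≤⟨ m≤n+m _ (Δ * Δ) ⟩
    Δ * Δ + (Δ + m′) * (Δ + m′)             ≡⟨ expand Δ m′ ⟩
    2 * Δ * (Δ + m′) + m′ * m′              ≤⟨ +-mono-≤ (*-monoʳ-≤ (2 * Δ) M≤s) ih ⟩
    2 * Δ * s + 2 * Δ * e′                  ≡⟨ *-distribˡ-+ (2 * Δ) s e′ ⟨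
    2 * Δ * (s + e′)                        ∎
    where
    open ≤-Reasoning
    open +-*-Solver
    expand : ∀ Δ m′ → Δ * Δ + (Δ + m′) * (Δ + m′) ≡ 2 * Δ * (Δ + m′) + m′ * m′
    expand = solve 2 (λ d m → d :* d :+ (d :+ m) :* (d :+ m) := con 2 :* d :* (d :+ m) :+ m :* m) refl

  module _ {Δ} (deg≤Δ : ∀ x → degree H x ≤ Δ) (1≤Δ : 1 ≤ Δ) where

    -- The recursion passes from `suc m` to `suc m ∸ Δ`, which is not structural; `fuel` decreases
    -- in its place because `1 ≤ Δ`.
    square-bound : ∀ {n} fuel m → m ≤ fuel → {A : Rel (Fin n) 0ℓ} (A? : B.Decidable A) → Symmetric A →
      (∀ {u} → ¬ A u u) → Forces A (suc m) → m * m ≤ 2 * Δ * length (edgesOf A?)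
    square-bound _          zero    _         A? A-sym A-irrefl forces = z≤n
    square-bound {n} (suc fuel) (suc m) (s≤s m≤fuel) {A} A? A-sym A-irrefl forces
      with Finₚ.any? (λ v → suc m ≤? length (neighbours A? v))
    ... | no small = ⊥-elim (1+n≰n (degree-bound A? A-sym A-irrefl (λ u → ≤-pred (≰⇒> λ big → small (u , big))) forces))
    ... | yes (v , big) = subst (λ e → suc m * suc m ≤ 2 * Δ * e) (sym (length-edgesOf-split A? atCentre?)) bound
      where
      open Star A? A-sym A-irrefl v
      s e′ : ℕ
      s  = length (edgesOf (A? ∩? atCentre?))
      e′ = length (edgesOf (A? ∖? atCentre?))
      forces′ : Forces (A ∖ AtCentre) (suc (suc m) ∸ Δ)
      forces′ = forces-delete atCentre? Sum.swap n (mapColours toℕ Finₚ.toℕ-injective starColouring)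
        (λ _ _ → Finₚ.toℕ<n _) (λ p _ → star≤degree v p deg≤Δ atCentre?) forces
      bound : suc m * suc m ≤ 2 * Δ * (s + e′)
      bound with suc m ≤? Δ
      -- The star alone suffices: `suc m` is at most `2 * Δ` and at most `s`.
      ... | yes m<Δ = *-mono-≤ (≤-trans m<Δ (m≤n*m Δ 2)) (≤-trans (≤-trans big degree≤star) (m≤m+n s e′))
      ... | no m≮Δ  = subst (λ M → M * M ≤ 2 * Δ * (s + e′)) (m+[n∸m]≡n Δ≤m)
        (quadratic-step Δ (suc m ∸ Δ) (subst (_≤ s) (sym (m+[n∸m]≡n Δ≤m)) (≤-trans big degree≤star))
          (square-bound fuel (suc m ∸ Δ) (≤-trans (∸-monoʳ-≤ (suc m) 1≤Δ) m≤fuel) (A? ∖? atCentre?)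
            (λ (a , ¬c) → A-sym a , ¬c ∘ Sum.swap) (A-irrefl ∘ proj₁)
            (subst (Forces _) (+-∸-assoc 1 Δ≤m) forces′)))
        where Δ≤m = <⇒≤ (≰⇒> m≮Δ)

  -- The triangular bound: deleting matchings

  module MatchingImage {A : Rel (Fin n) 0ℓ} (A? : B.Decidable A) (A-sym : Symmetric A) (A-irrefl : ∀ {u} → ¬ A u u)
    {q} (χ : EdgeColouring (Adj H) (Fin q)) (p : PartialCopy A) (i : ℕ) where

    Matched : Rel (Fin n) 0ℓ
    Matched u w = ∃[ x ] ∃[ y ] vertex p x ≡ u × vertex p y ≡ w × Part p x y × toℕ (colour χ x y) ≡ i

    matched? : B.Decidable Matched
    matched? u w = Finₚ.any? λ x → Finₚ.any? λ y →
      (vertex p x Finₚ.≟ u) ×-dec ((vertex p y Finₚ.≟ w) ×-dec (part? p x y ×-dec (toℕ (colour χ x y) ℕ.≟ i)))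

    matched-sym : Symmetric Matched
    matched-sym (x , y , φx , φy , b , c) =
      y , x , φy , φx , part-sym p b , trans (cong toℕ (sym (colour-sym χ (part⊆H p b)))) c

    -- By injectivity both edges come from one vertex of `H`, which has at most one edge in each
    -- colour class of `χ`.
    matched-unique : ∀ {u v w} → Matched u v → Matched u w → v ≡ w
    matched-unique (x , y , refl , refl , b , c) (x′ , y′ , φx′ , refl , b′ , c′)
      with refl ← injective p φx′ =
      cong (vertex p) (proper χ (part⊆H p b) (part⊆H p b′) (Finₚ.toℕ-injective (trans c (sym c′))))

    InClass : Pred (Vertex H × Vertex H) 0ℓ
    InClass (x , y) = toℕ (colour χ x y) ≡ i

    inClass? : Decidable InClass
    inClass? (x , y) = toℕ (colour χ x y) ℕ.≟ i

    class≤matched : length (filter inClass? (edgesOf (part? p))) ≤ length (edgesOf (A? ∩? matched?))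
    class≤matched = injection⇒length≤ (λ (x , y) → sort (vertex p x) (vertex p y))
      (Uniqueₚ.filter⁺ inClass? (edgesOf-unique (part? p)))
      (λ e∈ → let e∈B , c = ∈-filter⁻ inClass? e∈ ; _ , b = ∈-edgesOf⁻ (part? p) e∈B in
        sort-∈-edgesOf (A? ∩? matched?) (λ (a , μ) → A-sym a , matched-sym μ)
          (image p b , _ , _ , refl , refl , b , c) (λ eq → A-irrefl (subst (A _) (sym eq) (image p b))))
      (λ e∈ e′∈ eq →
        let x<y , _ = ∈-edgesOf⁻ (part? p) (proj₁ (∈-filter⁻ inClass? e∈))
            x′<y′ , _ = ∈-edgesOf⁻ (part? p) (proj₁ (∈-filter⁻ inClass? e′∈)) in
        sameEdge-sorted x<y x′<y′ (Sum.map (λ (s , t) → injective p s , injective p t)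
                                           (λ (s , t) → injective p s , injective p t) (sort-injective eq)))

    -- A matching is properly coloured by the single colour 0, and a rainbow partial copy contains
    -- at most one edge of that colour.
    forces-delete-matched : ∀ {m} → Forces A (suc m) → Forces (A ∖ Matched) m
    forces-delete-matched = forces-delete matched? matched-sym 1
      (record { colour = λ _ _ → 0 ; colour-sym = λ _ → refl
              ; proper = λ (_ , μ) (_ , μ′) _ → matched-unique μ μ′ })
      (λ _ _ → s≤s z≤n) one-edge
      where
      one-edge : ∀ (p′ : PartialCopy A) → RainbowOn p′ Matched (λ _ _ → 0) →
        length (edgesOf (part? p′ ∩? pullback? p′ matched?)) ≤ 1
      one-edge p′ rainbow = injection⇒length≤ {ys = tt ∷ []} (λ _ → tt) (edgesOf-unique B?) (λ _ → here refl)
        λ e∈ e′∈ _ → let x<y , b , μ = ∈-edgesOf⁻ B? e∈ ; x′<y′ , b′ , μ′ = ∈-edgesOf⁻ B? e′∈ in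
          sameEdge-sorted x<y x′<y′ (rainbow b b′ μ μ′ refl)
        where B? = part? p′ ∩? pullback? p′ matched?

  triangular-bound : ∀ {n q} → EdgeColouring (Adj H) (Fin (suc q)) → ∀ m {A : Rel (Fin n) 0ℓ} (A? : B.Decidable A) →
    Symmetric A → (∀ {u} → ¬ A u u) → Forces A m → m * suc m ≤ 2 * suc q * length (edgesOf A?)
  triangular-bound χ zero A? A-sym A-irrefl forces = z≤n
  triangular-bound {n} {q} χ (suc m) {A} A? A-sym A-irrefl forces = bound (forces κ)
    where
    open ≤-Reasoning
    κ : EdgeColouring A ℕ
    -- Only the size of the partial copy found matters, so the trivial degree bound `n` is enough.
    κ = mapColours toℕ Finₚ.toℕ-injective (vizing A? A-sym A-irrefl λ u → length-filter (A? u) (allFin n))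
    regroup : ∀ m → suc m * suc (suc m) ≡ 2 * suc m + m * suc m
    regroup = solve 1 (λ m → (con 1 :+ m) :* (con 2 :+ m) := con 2 :* (con 1 :+ m) :+ m :* (con 1 :+ m)) refl
      where open +-*-Solver
    bound : Σ[ p ∈ PartialCopy A ] RainbowOn p (λ _ _ → ⊤) (colour κ) × suc m ≤ size p →
      suc m * suc (suc m) ≤ 2 * suc q * length (edgesOf A?)
    bound (p , _ , m<size) = begin
      suc m * suc (suc m)                      ≡⟨ regroup m ⟩
      2 * suc m + m * suc m                    ≤⟨ +-mono-≤ (*-monoʳ-≤ 2 large-matching) ih ⟩
      2 * (suc q * s) + 2 * suc q * e′         ≡⟨ cong (_+ 2 * suc q * e′) (*-assoc 2 (suc q) s) ⟨
      2 * suc q * s + 2 * suc q * e′           ≡⟨ *-distribˡ-+ (2 * suc q) s e′ ⟨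
      2 * suc q * (s + e′)                     ≡⟨ cong (2 * suc q *_) (length-edgesOf-split A? matched?) ⟨
      2 * suc q * length (edgesOf A?)          ∎
      where
      class = largest-class (λ (x , y) → toℕ (colour χ x y)) (edgesOf (part? p)) q
      open MatchingImage A? A-sym A-irrefl χ p (proj₁ class)
      s e′ : ℕ
      s  = length (edgesOf (A? ∩? matched?))
      e′ = length (edgesOf (A? ∖? matched?))
      large-matching : suc m ≤ suc q * s
      -- Every colour in `Fin (suc q)` is at most `q`, so the first filter keeps all edges of the
      -- partial copy.
      large-matching = begin
        suc m       ≤⟨ m<size ⟩
        size p      ≡⟨ cong length (filter-all (λ (x , y) → toℕ (colour χ x y) ≤? q)
                         (All.universal (λ _ → ≤-pred (Finₚ.toℕ<n _)) (edgesOf (part? p)))) ⟨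
        length (filter (λ (x , y) → toℕ (colour χ x y) ≤? q) (edgesOf (part? p)))
                    ≤⟨ proj₂ class ⟩
        suc q * length (filter inClass? (edgesOf (part? p)))
                    ≤⟨ *-monoʳ-≤ (suc q) class≤matched ⟩
        suc q * s   ∎
      ih : m * suc m ≤ 2 * suc q * e′
      ih = triangular-bound χ m (A? ∖? matched?) (λ (a , ¬μ) → A-sym a , ¬μ ∘ matched-sym) (A-irrefl ∘ proj₁)
        (forces-delete-matched forces)

-- From graphs to relations, and the theorem

toEdgeColouring : ∀ {H q} → ProperColouring H (Fin (suc q)) → EdgeColouring (Adj H) (Fin (suc q))
toEdgeColouring {H} {q} P = record
  { colour     = total
  ; colour-sym = λ {u} {v} e → trans (total-adj e)
      (trans (P.colour-sym u v e (Graph.symmetric H e)) (sym (total-adj (Graph.symmetric H e))))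
  ; proper     = λ {u} {v} {w} e f eq → decidable-stable (v Finₚ.≟ w) λ v≢w →
      P.proper u v w e f v≢w (trans (sym (total-adj e)) (trans eq (total-adj f)))
  }
  where
  module P = ProperColouring P
  total : Vertex H → Vertex H → Fin (suc q)
  total u v with T? (Graph.adj H u v)
  ... | yes e = P.colour u v e
  -- Non-edges need some colour, hence the successor in `Fin (suc q)`.
  ... | no _  = Fin.zero
  total-adj : ∀ {u v} (e : Adj H u v) → total u v ≡ P.colour u v e
  total-adj {u} {v} e with T? (Graph.adj H u v)
  ... | yes e′ = cong (P.colour u v) (T-irrelevant e′ e)
  ... | no ¬e  = ⊥-elim (¬e e)

forcesRainbow⇒forces : ∀ {G H} → ForcesRainbow G H → Forcing.Forces H (Adj G) (numEdges H)
forcesRainbow⇒forces {G} {H} forces κ with forces (record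
    { colour     = λ u v _ → colour κ u v
    ; colour-sym = λ _ _ e _ → colour-sym κ e
    ; proper     = λ _ _ _ e f v≢w eq → v≢w (proper κ e f eq)
    })
... | φ , rainbow = record
    { vertex    = Copy.vertex φ
    ; injective = Copy.injective φ
    ; Part      = Adj H
    ; part?     = λ u v → T? (Graph.adj H u v)
    ; part-sym  = Graph.symmetric H
    ; part⊆H    = id
    ; image     = Copy.edge φ
    } , (λ e f _ _ eq → rainbow _ _ _ _ e f eq) , ≤-refl

degree≤maxDegree : ∀ H x → degree H x ≤ maxDegree H
degree≤maxDegree H x = All.lookup (xs≤max 0 (map (degree H) (allFin _))) (∈-map⁺ (degree H) (∈-allFin x))

-- An end of an edge has a neighbour. Positivity makes the recursion in `square-bound` decrease and
-- provides the default colour of `toEdgeColouring`.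
maxDegree-positive : ∀ H → 1 ≤ numEdges H → 1 ≤ maxDegree H
maxDegree-positive H 1≤e with edges H in eq
... | (u , v) ∷ _ = ≤-trans (positive-length (∈-filter⁺ (λ w → T? (Graph.adj H u w)) (∈-allFin v) uv))
                            (degree≤maxDegree H u)
  where
  uv : Adj H u v
  uv = proj₂ (∈-edgesOf⁻ (λ u v → T? (Graph.adj H u v)) (subst ((u , v) ∈_) (sym eq) (here refl)))
  positive-length : ∀ {X : Set} {x : X} {xs} → x ∈ xs → 1 ≤ length xs
  positive-length (here _)  = s≤s z≤n
  positive-length (there _) = s≤s z≤n

lemma5 : (H : Graph) (k Δ a : ℕ) →
    numEdges H ≡ k → 1 ≤ k → maxDegree H ≡ Δ → IsARₛ H a →
    ((k ∸ 1) ^ 2 ≤ 2 * Δ * a) ×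
    (IsChromaticIndex H Δ → k * (k + 1) ≤ 2 * Δ * a)
lemma5 H (suc k) Δ a e≡k 1≤k refl ((G , refl , forcesRainbow) , _) = square , triangular
  where
  adj? = λ u v → T? (Graph.adj G u v)
  forces : Forcing.Forces H (Adj G) (suc k)
  forces = subst (Forcing.Forces H (Adj G)) e≡k (forcesRainbow⇒forces forcesRainbow)
  1≤Δ : 1 ≤ maxDegree H
  1≤Δ = maxDegree-positive H (subst (1 ≤_) (sym e≡k) 1≤k)
  square : k ^ 2 ≤ 2 * maxDegree H * numEdges G
  -- `k ^ 2` unfolds to `k * (k * 1)`.
  square = subst (λ K → k * K ≤ 2 * maxDegree H * numEdges G) (sym (*-identityʳ k))
    (Forcing.square-bound H (degree≤maxDegree H) 1≤Δ k k ≤-refl adj? (Graph.symmetric G) (Graph.loopless G _) forces)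
  -- With the number of colours abstracted, matching on `1 ≤ q` exposes it as a successor.
  triangular-of : ∀ {q} → 1 ≤ q → ProperColouring H (Fin q) → suc k * suc (suc k) ≤ 2 * q * numEdges G
  triangular-of (s≤s _) χ = Forcing.triangular-bound H (toEdgeColouring χ) (suc k) adj?
    (Graph.symmetric G) (Graph.loopless G _) forces
  triangular : IsChromaticIndex H (maxDegree H) → suc k * (suc k + 1) ≤ 2 * maxDegree H * numEdges G
  triangular (χ , _) = subst (λ K → suc k * K ≤ 2 * maxDegree H * numEdges G) (+-comm 1 (suc k)) (triangular-of 1≤Δ χ)
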